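{- For $\Delta=4$ and $k=0$ there is a gadget, i.e. a realizable instance of $4$-$0$-DiTTR, that enforces $\lambda(v_1,v_2)=\lambda(v_2,v_1)$ for some pair of adjacent vertices $(v_1,v_2)$.
   Context: All graphs are finite. A $\Delta$-periodic labeling of a directed graph $G=(V,E)$ is a map $\lambda:E\to\{0,1,\dots,\Delta-1\}$; edge $e$ is then active exactly at the times $\lambda(e)+i\Delta$, $i\in\mathbb{N}_0$. A temporal $s$-$z$-path is a sequence $(v_{i-1},v_i,t_i)_{i=1}^{\ell}$ with $v_0=s$, $v_\ell=z$, pairwise distinct vertices $v_0,\dots,v_\ell$, $(v_{i-1},v_i)\in E$ active at time $t_i$ for every $i$, and $t_1<t_2<\dots<t_\ell$ (strictly increasing). Its duration is $t_\ell+1-t_1$. A fastest temporal path is one of minimum duration. $\hat d(u,v)$ is the distance from $u$ to $v$ in the static graph $G$ (all edges have unit length). A bidirected tree is the directed graph obtained from an undirected tree by replacing each edge $\{u,v\}$ by the two directed edges $(u,v),(v,u)$ (which may get different labels). For integers $\Delta\ge1,k\ge0$, an instance of $\Delta$-$k$-DiTTR consists of a bidirected tree $G=(V,E)$ and a matrix $D$ indexed by $V\times V$ with entries positive integers or $\infty$ (no restriction) such that $D_{u,v}\ge\hat d(u,v)+k$ for all $u,v$. A valid labeling is a $\Delta$-periodic labeling $\lambda$ of $E$ such that, for all $u,v\in V$, the duration of a fastest temporal path from $u$ to $v$ is at most $D_{u,v}$; the instance is realizable if a valid labeling exists. Diagonal entries of $D$ play no role; all conditions on $D$ are for distinct vertices.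 An instance enforces $\lambda(v_1,v_2)=\lambda(v_2,v_1)$ if this equality holds for every valid labeling $\lambda$. -}

module Defs where

open import Data.Bool.Base using (Bool; T)
open import Data.Fin.Base as Fin using (Fin; zero; suc; inject₁; fromℕ; toℕ)
open import Data.Nat.Base using (ℕ; zero; suc; _+_; _*_; _∸_; _≤_; _<_; NonZero)
open import Data.Product.Base using (Σ-syntax; ∃-syntax; _×_; _,_)
open import Function.Definitions using (Injective)
open import Relation.Binary.Construct.Add.Supremum.NonStrict _≤_ using (_≤⁺_)
open import Relation.Binary.PropositionalEquality.Core using (_≡_; _≢_)
open import Relation.Nullary.Construct.Add.Supremum using (_⁺; [_])
open import Relation.Nullary.Negation.Core using (¬_)

-- Directed graphs on the vertex set Fin order.  Edges are Bool-valued so that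
-- the type Edge u v has at most one element and a labeling of the edge set
-- cannot depend on the choice of an adjacency proof.
record Digraph : Set where
  field
    order : ℕ
    edge  : Fin order → Fin order → Bool

  V : Set
  V = Fin order

  Edge : V → V → Set
  Edge u v = T (edge u v)

  E : Set
  E = Σ[ u ∈ V ] Σ[ v ∈ V ] Edge u v

record Graph : Set where
  field
    order  : ℕ
    adj    : Fin order → Fin order → Bool
    symm   : ∀ {u v} → T (adj u v) → T (adj v u)
    irrefl : ∀ {v} → ¬ T (adj v v)

bidirected : Graph → Digraph
bidirected H = record { order = Graph.order H ; edge = Graph.adj H }

-- The value 0 for the edgeless path is a convention; that path only
-- exists from a vertex to itself.
span : (ℓ : ℕ) → (Fin ℓ → ℕ) → ℕ
span zero    t = 0
span (suc m) t = (t (fromℕ m) + 1) ∸ t zero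

module _ (G : Digraph) where
  open Digraph G

  record Path (ℓ : ℕ) (u v : V) : Set where
    field
      vertex   : Fin (suc ℓ) → V
      start    : vertex zero ≡ u
      end      : vertex (fromℕ ℓ) ≡ v
      distinct : Injective _≡_ _≡_ vertex
      step     : (i : Fin ℓ) → Edge (vertex (inject₁ i)) (vertex (suc i))

    edgeAt : Fin ℓ → E
    edgeAt i = vertex (inject₁ i) , vertex (suc i) , step i

  -- "d is the distance from u to v": the length of a shortest path.
  IsDistance : V → V → ℕ → Set
  IsDistance u v d = Path d u v × (∀ {ℓ} → Path ℓ u v → d ≤ ℓ)

  Labeling : ℕ → Set
  Labeling Δ = E → Fin Δ

  module _ {Δ : ℕ} (lab : Labeling Δ) where

    ActiveAt : E → ℕ → Set
    ActiveAt e t = ∃[ i ] t ≡ toℕ (lab e) + i * Δ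

    record TemporalPath (u v : V) : Set where
      field
        {len}      : ℕ
        path       : Path len u v
        time       : Fin len → ℕ
        active     : ∀ i → ActiveAt (Path.edgeAt path i) (time i)
        increasing : ∀ {i j} → i Fin.< j → time i < time j

    duration : ∀ {u v} → TemporalPath u v → ℕ
    duration p = span (TemporalPath.len p) (TemporalPath.time p)

    IsFastest : ∀ {u v} → TemporalPath u v → Set
    IsFastest {u} {v} p = (q : TemporalPath u v) → duration p ≤ duration q

-- A cycle is a path with at least two edges together with an edge from its
-- last vertex back to its first.
record IsTree (H : Graph) : Set where
  open Digraph (bidirected H) using (V; Edge)
  field
    nonempty  : NonZero (Graph.order H)
    connected : (u v : V) → ∃[ ℓ ] Path (bidirected H) ℓ u v
    acyclic   : ∀ {ℓ} {u v : V} → 2 ≤ ℓ → Path (bidirected H) ℓ u v → ¬ Edge v u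

-- Instances of Δ-k-DiTTR.  In ℕ ⁺ the added top element stands for ∞.
record DiTTR (Δ k : ℕ) .{{_ : NonZero Δ}} : Set where
  field
    tree   : Graph
    isTree : IsTree tree

  G : Digraph
  G = bidirected tree

  open Digraph G public using (V; E; Edge)

  field
    D          : V → V → ℕ ⁺
    D-positive : ∀ {u v} → u ≢ v → [ 1 ] ≤⁺ D u v
    D-bound    : ∀ {u v d} → u ≢ v → IsDistance G u v d → [ d + k ] ≤⁺ D u v

  -- An entry ∞ imposes no restriction.
  Valid : Labeling G Δ → Set
  Valid lab = ∀ {u v d} → u ≢ v → D u v ≡ [ d ] →
    Σ[ p ∈ TemporalPath G lab u v ] IsFastest G lab p × duration G lab p ≤ d

  Realizable : Set
  Realizable = Σ[ lab ∈ Labeling G Δ ] Valid lab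

  EnforcesEqual : (v₁ v₂ : V) → Edge v₁ v₂ → Set
  EnforcesEqual v₁ v₂ e = (lab : Labeling G Δ) → Valid lab →
    lab (v₁ , v₂ , e) ≡ lab (v₂ , v₁ , Graph.symm tree e)

{-# OPTIONS --safe #-}

-- Two vertices c₁, c₂ are joined by an edge; c₁ carries leaves p₁, q₁ and c₂
-- carries leaves p₂, q₂.  Between vertices at distance two, a bound D = d says
-- that the label of the second edge exceeds that of the first, modulo 4, by one
-- of 1, …, d - 1.  Write x = λ(c₁,c₂) and y = λ(c₂,c₁).  At c₁ the bounds
-- D(p₁,c₂) = 2, D(p₁,q₁) = 3, D(c₂,q₁) = 2 give
--   x - y = (x - λ(p₁,c₁)) - (λ(c₁,q₁) - λ(p₁,c₁)) + (λ(c₁,q₁) - y) ∈ 1 - {1,2} + 1 = {0,1},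
-- and the same bounds at c₂ give y - x ∈ {0,1}; hence x = y.
module Submission where

open import Defs
open import Data.Bool.Base using (Bool; true; false)
open import Data.Bool.Properties using (T-irrelevant)
open import Data.Fin.Base using (Fin; zero; suc; inject₁; inject≤; fromℕ; toℕ)
open import Data.Fin.Properties using (_≟_; all?; any?; suc-injective; toℕ-injective; toℕ-fromℕ; toℕ-inject₁; toℕ-inject≤; inject≤-injective; toℕ<n; toℕ≤pred[n])
open import Data.Maybe.Relation.Unary.All as Maybe using (just)
open import Data.Nat.Base using (ℕ; zero; suc; _+_; _*_; _∸_; _≤_; _<_; z≤n; s≤s; nonZero)
open import Data.Nat.DivMod using (_/_; _%_; [m+kn]%n≡m%n; m%n≤m; m≡m%n+[m/n]*n)
open import Data.Nat.Properties using (_<?_; _≤?_; ≤-reflexive; ≤-trans; +-comm; +-monoʳ-≤; +-identityʳ; m∸n+n≡m; m+n∸m≡n; m≤n⇒∃[o]m+o≡n)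
open import Data.Nat.Solver using (module +-*-Solver)
open import Data.Product.Base using (Σ-syntax; ∃-syntax; _×_; _,_; proj₁; proj₂)
open import Data.Sum.Base using (_⊎_; inj₁; inj₂)
open import Data.Vec.Base using ([]; _∷_; lookup)
open import Function.Base using (_∘_)
open import Relation.Binary.Construct.Add.Supremum.NonStrict _≤_ using (_≤⁺_; [_]; _≤⊤⁺)
open import Relation.Binary.PropositionalEquality
open import Relation.Nullary.Construct.Add.Supremum using (_⁺; [_]; ⊤⁺)
open import Relation.Nullary.Decidable using (Dec; yes; no; T?; from-yes; ¬?; _×-dec_; _⊎-dec_; _→-dec_)
open import Relation.Nullary.Negation.Core using (¬_; contradiction)

-- Waiting times between labels modulo the period.

module _ {n : ℕ} where

  -- The waiting time from a to b: the element of {1, …, suc n} congruent to b - a.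
  gap : Fin (suc n) → Fin (suc n) → ℕ
  gap a b = suc ((toℕ b + (n ∸ toℕ a)) % suc n)

  -- The hypothesis describes an activity of `b` that comes `suc k` time units after one of `a`.
  -- Adding `n ∸ toℕ a` to both sides shows that `k` is congruent to `toℕ b + (n ∸ toℕ a)`, and
  -- `gap a b` is one more than the least such residue.
  gap-minimal : ∀ a b {i j k} →
    suc (toℕ a + i * suc n) + k ≡ toℕ b + j * suc n → gap a b ≤ suc k
  gap-minimal a b {i} {j} {k} eq = s≤s (≤-trans (≤-reflexive same-residue) (m%n≤m k (suc n)))
    where
    open ≡-Reasoning
    open +-*-Solver
    c = n ∸ toℕ a

    c+a≡n : c + toℕ a ≡ n
    c+a≡n = m∸n+n≡m (toℕ≤pred[n] a)

    shifted : (toℕ b + c) + j * suc n ≡ k + suc i * suc n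
    shifted = begin
      (toℕ b + c) + j * suc n                      ≡⟨ solve 3 (λ b c s → (b :+ c) :+ s := c :+ (b :+ s)) refl (toℕ b) c (j * suc n) ⟩
      c + (toℕ b + j * suc n)                      ≡⟨ cong (c +_) eq ⟨
      c + (suc (toℕ a + i * suc n) + k)            ≡⟨ solve 4 (λ a c s k → c :+ ((con 1 :+ (a :+ s)) :+ k) := k :+ ((con 1 :+ (c :+ a)) :+ s)) refl (toℕ a) c (i * suc n) k ⟩
      k + (suc (c + toℕ a) + i * suc n)            ≡⟨ cong (λ m → k + (suc m + i * suc n)) c+a≡n ⟩
      k + suc i * suc n                            ∎

    same-residue : (toℕ b + c) % suc n ≡ k % suc n
    same-residue = begin
      (toℕ b + c) % suc n                ≡⟨ [m+kn]%n≡m%n (toℕ b + c) j (suc n) ⟨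
      ((toℕ b + c) + j * suc n) % suc n  ≡⟨ cong (_% suc n) shifted ⟩
      (k + suc i * suc n) % suc n        ≡⟨ [m+kn]%n≡m%n k (suc i) (suc n) ⟩
      k % suc n                          ∎

  -- The witness is the quotient whose remainder defines `gap`. The arrival is put in period 1,
  -- leaving room for a departure before it even when `b` is smaller than `a`.
  gap-attained : ∀ a b → ∃[ i ] (toℕ a + i * suc n) + gap a b ≡ toℕ b + 1 * suc n
  gap-attained a b = q , (begin
    (toℕ a + q * suc n) + suc r        ≡⟨ solve 3 (λ a s r → (a :+ s) :+ (con 1 :+ r) := con 1 :+ (a :+ (r :+ s))) refl (toℕ a) (q * suc n) r ⟩
    suc (toℕ a + (r + q * suc n))      ≡⟨ cong (λ m → suc (toℕ a + m)) (m≡m%n+[m/n]*n (toℕ b + c) (suc n)) ⟨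
    suc (toℕ a + (toℕ b + c))          ≡⟨ solve 3 (λ a b c → con 1 :+ (a :+ (b :+ c)) := b :+ (con 1 :+ (c :+ a))) refl (toℕ a) (toℕ b) c ⟩
    toℕ b + suc (c + toℕ a)            ≡⟨ cong (λ m → toℕ b + suc m) (m∸n+n≡m (toℕ≤pred[n] a)) ⟩
    toℕ b + suc n                      ≡⟨ cong (toℕ b +_) (+-identityʳ (suc n)) ⟨
    toℕ b + 1 * suc n                  ∎)
    where
    open ≡-Reasoning
    open +-*-Solver
    c = n ∸ toℕ a
    q = (toℕ b + c) / suc n
    r = (toℕ b + c) % suc n

-- Operations on paths.

module _ {G : Digraph} where
  open Digraph G
  open Path

  E-≡ : ∀ {u u′ v v′} {e : Edge u v} {e′ : Edge u′ v′} →
    u ≡ u′ → v ≡ v′ → _≡_ {A = E} (u , v , e) (u′ , v′ , e′)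
  E-≡ refl refl = cong (λ e → _ , _ , e) (T-irrelevant _ _)

  cons : ∀ {w u v ℓ} → Edge w u → (P : Path G ℓ u v) →
    (∀ i → vertex P i ≢ w) → Path G (suc ℓ) w v
  cons {w} wu P w∉P = record
    { vertex   = vertex′
    ; start    = refl
    ; end      = end P
    ; distinct = distinct′
    ; step     = λ { zero → subst (Edge w) (sym (start P)) wu ; (suc i) → step P i }
    }
    where
    vertex′ : Fin _ → V
    vertex′ zero    = w
    vertex′ (suc i) = vertex P i

    distinct′ : ∀ {i j} → vertex′ i ≡ vertex′ j → i ≡ j
    distinct′ {zero}  {zero}  eq = refl
    distinct′ {zero}  {suc j} eq = contradiction (sym eq) (w∉P j)
    distinct′ {suc i} {zero}  eq = contradiction eq (w∉P i)
    distinct′ {suc i} {suc j} eq = cong suc (distinct P eq)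

  tail : ∀ {u v ℓ} (P : Path G (suc ℓ) u v) → Path G ℓ (vertex P (suc zero)) v
  tail P = record
    { vertex   = vertex P ∘ suc
    ; start    = refl
    ; end      = end P
    ; distinct = suc-injective ∘ distinct P
    ; step     = step P ∘ suc
    }

  prefix : ∀ {u v ℓ} (P : Path G ℓ u v) i → Path G (toℕ i) u (vertex P i)
  prefix {ℓ = ℓ} P i = record
    { vertex   = λ j → vertex P (inject≤ j (toℕ<n i))
    ; start    = start P
    ; end      = cong (vertex P) (toℕ-injective (trans (toℕ-inject≤ _ (toℕ<n i)) (toℕ-fromℕ _)))
    ; distinct = λ eq → inject≤-injective (toℕ<n i) (toℕ<n i) _ _ (distinct P eq)
    ; step     = λ j → subst (λ k → Edge (vertex P k) (vertex P (inject≤ (suc j) (toℕ<n i)))) (commute j) (step P (inject≤ j i≤ℓ))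
    }
    where
    i≤ℓ : toℕ i ≤ ℓ
    i≤ℓ = toℕ≤pred[n] i

    commute : ∀ j → inject₁ (inject≤ j i≤ℓ) ≡ inject≤ (inject₁ j) (toℕ<n i)
    commute j = toℕ-injective (begin
      toℕ (inject₁ (inject≤ j i≤ℓ))           ≡⟨ toℕ-inject₁ _ ⟩
      toℕ (inject≤ j i≤ℓ)                     ≡⟨ toℕ-inject≤ j i≤ℓ ⟩
      toℕ j                                   ≡⟨ toℕ-inject₁ j ⟨
      toℕ (inject₁ j)                         ≡⟨ toℕ-inject≤ (inject₁ j) (toℕ<n i) ⟨
      toℕ (inject≤ (inject₁ j) (toℕ<n i))     ∎)
      where open ≡-Reasoning

  trivial : ∀ {u v} → Path G 0 u v → u ≡ v
  trivial P = trans (sym (start P)) (end P)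

-- Vertices at distance two in a bidirected tree.

module _ {H : Graph} (isTree : IsTree H) where
  open Graph H using (symm; irrefl)
  open IsTree isTree
  open Path

  private
    G = bidirected H

  open Digraph G using (V; Edge)

  module _ {u w v : V} (u≢v : u ≢ v) (uw : Edge u w) (wv : Edge w v) where

    twoHop : Path G 2 u v
    twoHop = record
      { vertex   = vertices
      ; start    = refl
      ; end      = refl
      ; distinct = distinct′
      ; step     = λ { zero → uw ; (suc zero) → wv }
      }
      where
      vertices : Fin 3 → V
      vertices = lookup (u ∷ w ∷ v ∷ [])

      u≢w : u ≢ w
      u≢w refl = irrefl uw

      w≢v : w ≢ v
      w≢v refl = irrefl wv

      distinct′ : ∀ {i j} → vertices i ≡ vertices j → i ≡ j
      distinct′ {zero}          {zero}          eq = refl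
      distinct′ {zero}          {suc zero}      eq = contradiction eq u≢w
      distinct′ {zero}          {suc (suc zero)} eq = contradiction eq u≢v
      distinct′ {suc zero}      {zero}          eq = contradiction (sym eq) u≢w
      distinct′ {suc zero}      {suc zero}      eq = refl
      distinct′ {suc zero}      {suc (suc zero)} eq = contradiction eq w≢v
      distinct′ {suc (suc zero)} {zero}          eq = contradiction (sym eq) u≢v
      distinct′ {suc (suc zero)} {suc zero}      eq = contradiction (sym eq) w≢v
      distinct′ {suc (suc zero)} {suc (suc zero)} eq = refl

    -- A path avoiding w closes to a cycle through w.
    meets-middle : ∀ {ℓ} (P : Path G ℓ u v) → ∃[ i ] vertex P i ≡ w
    meets-middle {zero}  P = contradiction (trivial P) u≢v
    meets-middle {suc ℓ} P with any? (λ i → vertex P i ≟ w)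
    ... | yes found = found
    ... | no  w∉P   = contradiction (symm wv)
      (acyclic (s≤s (s≤s z≤n)) (cons (symm uw) P (λ i eq → w∉P (i , eq))))

    -- If `w` occurred later, the part of `P` up to `w` would close to a cycle through the edge from
    -- `w` back to `u`.
    middle-second : ∀ {ℓ} (P : Path G (suc ℓ) u v) → vertex P (suc zero) ≡ w
    middle-second P with meets-middle P
    ... | zero        , eq = contradiction (subst (Edge u) (trans (sym eq) (start P)) uw) irrefl
    ... | suc zero    , eq = eq
    ... | suc (suc i) , eq = contradiction (subst (λ x → Edge x u) (sym eq) (symm uw))
      (acyclic (s≤s (s≤s z≤n)) (prefix P (suc (suc i))))

    -- A single edge would force `v ≡ w`. With three or more edges, the rest of the path after `u`
    -- runs from `w` to `v` and closes to a cycle through the edge from `v` to `w`.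
    length≡2 : ∀ {ℓ} → Path G ℓ u v → ℓ ≡ 2
    length≡2 {0}                 P = contradiction (trivial P) u≢v
    length≡2 {1}                 P = contradiction (subst (Edge w) (trans (sym (end P)) (middle-second P)) wv) irrefl
    length≡2 {2}                 P = refl
    length≡2 {suc (suc (suc ℓ))} P = contradiction (subst (Edge v) (sym (middle-second P)) (symm wv))
      (acyclic (s≤s (s≤s z≤n)) (tail P))

    module _ {n : ℕ} (lab : Labeling G (suc n)) where
      private
        a = lab (u , w , uw)
        b = lab (w , v , wv)

      -- Every such path uses exactly the edges labeled `a` and `b`, so its two times differ by at
      -- least `gap a b`. The inequality is strict because the duration is this difference plus one.
      gap<duration : (p : TemporalPath G lab u v) → gap a b < duration G lab p
      gap<duration p with TemporalPath.len p | TemporalPath.path p | TemporalPath.time p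
                        | TemporalPath.active p | TemporalPath.increasing p
      ... | ℓ | P | t | active | increasing with refl ← length≡2 P =
        let i , t₀≡ = active zero
            j , t₁≡ = active (suc zero)
            k , t₀+k≡t₁ = m≤n⇒∃[o]m+o≡n (increasing {zero} {suc zero} (s≤s z≤n))
            a≡ = cong (toℕ ∘ lab) (E-≡ (start P) (middle-second P))
            b≡ = cong (toℕ ∘ lab) (E-≡ (middle-second P) (end P))
            T₀≡ = trans t₀≡ (cong (_+ i * suc n) a≡)
            T₁≡ = trans t₁≡ (cong (_+ j * suc n) b≡)
            eq = subst₂ (λ x y → suc x + k ≡ y) T₀≡ T₁≡ t₀+k≡t₁
        in ≤-trans (s≤s (gap-minimal a b {i} {j} {k} eq)) (≤-reflexive (sym (span≡ (t zero) k (t (suc zero)) t₀+k≡t₁)))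
        where
        span≡ : ∀ x k y → suc x + k ≡ y → (y + 1) ∸ x ≡ suc (suc k)
        span≡ x k _ refl = trans (cong (_∸ x) (solve 2 (λ x k → (con 1 :+ x :+ k) :+ con 1 := x :+ (con 2 :+ k)) refl x k)) (m+n∸m≡n x _)
          where open +-*-Solver

      fastest : Σ[ p ∈ TemporalPath G lab u v ] IsFastest G lab p × duration G lab p ≡ suc (gap a b)
      fastest = p , (λ q → ≤-trans (≤-reflexive dur) (gap<duration q)) , dur
        where
        -- Departing in this period makes the second edge active exactly `gap a b` later, which
        -- meets the lower bound `gap<duration`.
        i  = proj₁ (gap-attained a b)
        t₀ = toℕ a + i * suc n

        time′ : Fin 2 → ℕ
        time′ zero       = t₀
        time′ (suc zero) = t₀ + gap a b

        p : TemporalPath G lab u v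
        p = record
          { path       = twoHop
          ; time       = time′
          ; active     = λ { zero → i , refl ; (suc zero) → 1 , proj₂ (gap-attained a b) }
          ; increasing = λ { {zero} {suc zero} _ → subst (_≤ t₀ + gap a b) (+-comm t₀ 1) (+-monoʳ-≤ t₀ (s≤s z≤n))
                           ; {suc zero} {suc zero} (s≤s ()) }
          }

        dur : duration G lab p ≡ suc (gap a b)
        dur = trans (cong (_∸ t₀) (solve 2 (λ t g → (t :+ g) :+ con 1 := t :+ (con 1 :+ g)) refl t₀ (gap a b))) (m+n∸m≡n t₀ _)
          where open +-*-Solver

-- The gadget as a tree.

pattern c₁ = zero
pattern c₂ = suc zero
pattern p₁ = suc (suc zero)
pattern q₁ = suc (suc (suc zero))
pattern p₂ = suc (suc (suc (suc zero)))
pattern q₂ = suc (suc (suc (suc (suc zero))))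

adj : Fin 6 → Fin 6 → Bool
adj c₁ c₂ = true
adj c₁ p₁ = true
adj c₁ q₁ = true
adj c₂ c₁ = true
adj c₂ p₂ = true
adj c₂ q₂ = true
adj p₁ c₁ = true
adj q₁ c₁ = true
adj p₂ c₂ = true
adj q₂ c₂ = true
adj _  _  = false

gadget : Graph
gadget = record
  { order  = 6
  ; adj    = adj
  ; symm   = λ {u} {v} → from-yes (all? λ u → all? λ v → T? (adj u v) →-dec T? (adj v u)) u v
  ; irrefl = λ {v} → from-yes (all? λ v → ¬? (T? (adj v v))) v
  }

private
  G = bidirected gadget

open Digraph G using (V; Edge)

-- The fields of `Path` as a conjunction of decidable conditions, so that concrete paths are
-- verified by evaluation.
IsPath : ∀ {ℓ} → V → V → (Fin (suc ℓ) → V) → Set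
IsPath {ℓ} u v f = f zero ≡ u × f (fromℕ ℓ) ≡ v
  × (∀ i j → f i ≡ f j → i ≡ j) × (∀ i → Edge (f (inject₁ i)) (f (suc i)))

isPath? : ∀ {ℓ} u v (f : Fin (suc ℓ) → V) → Dec (IsPath u v f)
isPath? {ℓ} u v f = (f zero ≟ u) ×-dec (f (fromℕ ℓ) ≟ v)
  ×-dec (all? λ i → all? λ j → (f i ≟ f j) →-dec (i ≟ j))
  ×-dec (all? λ i → T? (adj (f (inject₁ i)) (f (suc i))))

toPath : ∀ {ℓ u v} {f : Fin (suc ℓ) → V} → IsPath u v f → Path G ℓ u v
toPath {f = f} (start , end , distinct , step) = record
  { vertex = f ; start = start ; end = end ; distinct = λ {i} {j} → distinct i j ; step = step }

hub : V → V
hub c₁ = c₁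
hub p₁ = c₁
hub q₁ = c₁
hub _  = c₂

-- For u ≢ v, the walk u, hub u, hub v, v with repetitions removed.
route : V → V → Σ[ ℓ ∈ ℕ ] (Fin (suc ℓ) → V)
route u v with u ≟ v | u ≟ hub u | hub u ≟ hub v | hub v ≟ v
... | yes _ | _     | _     | _     = 0 , lookup (u ∷ [])
... | no _  | yes _ | yes _ | _     = 1 , lookup (u ∷ v ∷ [])
... | no _  | yes _ | no _  | yes _ = 1 , lookup (u ∷ v ∷ [])
... | no _  | yes _ | no _  | no _  = 2 , lookup (u ∷ hub v ∷ v ∷ [])
... | no _  | no _  | yes _ | yes _ = 1 , lookup (u ∷ v ∷ [])
... | no _  | no _  | yes _ | no _  = 2 , lookup (u ∷ hub u ∷ v ∷ [])
... | no _  | no _  | no _  | yes _ = 2 , lookup (u ∷ hub u ∷ v ∷ [])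
... | no _  | no _  | no _  | no _  = 3 , lookup (u ∷ hub u ∷ hub v ∷ v ∷ [])

route-isPath : ∀ u v → IsPath u v (proj₂ (route u v))
route-isPath = from-yes (all? λ u → all? λ v → isPath? u v (proj₂ (route u v)))

branching : ∀ v x y → Edge v x → Edge v y → x ≢ y → v ≡ c₁ ⊎ v ≡ c₂
branching = from-yes (all? λ v → all? λ x → all? λ y →
  T? (adj v x) →-dec T? (adj v y) →-dec ¬? (x ≟ y) →-dec ((v ≟ c₁) ⊎-dec (v ≟ c₂)))

-- Every vertex of a cycle has two neighbours, but only c₁ and c₂ do.
gadget-acyclic : ∀ {ℓ} {u v : V} → 2 ≤ ℓ → Path G ℓ u v → ¬ Edge v u
gadget-acyclic {suc (suc ℓ)} (s≤s (s≤s _)) P vu =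
  -- The first, second and last vertices are pairwise distinct since the path has at least two
  -- edges.
  pigeonhole (branching (vertex zero) _ _ (step zero) last-zero (≢-vertex λ ()))
             (branching (vertex (suc zero)) _ _ (symm (step zero)) (step (suc zero)) (≢-vertex λ ()))
             (branching (vertex (fromℕ (2 + ℓ))) _ _ (symm last-zero) (symm (step (fromℕ (suc ℓ)))) (≢-vertex λ ()))
             (≢-vertex λ ()) (≢-vertex λ ()) (≢-vertex λ ())
  where
  open Path P
  open Graph gadget using (symm)

  last-zero : Edge (vertex zero) (vertex (fromℕ (2 + ℓ)))
  last-zero = subst₂ Edge (sym start) (sym end) (symm vu)

  ≢-vertex : ∀ {i j} → i ≢ j → vertex i ≢ vertex j
  ≢-vertex i≢j eq = i≢j (distinct eq)

  pigeonhole : ∀ {x y z : V} → x ≡ c₁ ⊎ x ≡ c₂ → y ≡ c₁ ⊎ y ≡ c₂ → z ≡ c₁ ⊎ z ≡ c₂ →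
    x ≢ y → x ≢ z → ¬ y ≢ z
  pigeonhole (inj₁ refl) (inj₁ refl) _           x≢y _   _   = x≢y refl
  pigeonhole (inj₂ refl) (inj₂ refl) _           x≢y _   _   = x≢y refl
  pigeonhole (inj₁ refl) (inj₂ refl) (inj₁ refl) _   x≢z _   = x≢z refl
  pigeonhole (inj₁ refl) (inj₂ refl) (inj₂ refl) _   _   y≢z = y≢z refl
  pigeonhole (inj₂ refl) (inj₁ refl) (inj₁ refl) _   _   y≢z = y≢z refl
  pigeonhole (inj₂ refl) (inj₁ refl) (inj₂ refl) _   x≢z _   = x≢z refl

gadget-isTree : IsTree gadget
gadget-isTree = record
  { nonempty  = nonZero
  ; connected = λ u v → proj₁ (route u v) , toPath (route-isPath u v)
  ; acyclic   = gadget-acyclic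
  }

-- The bounds and a labeling that meets them.

D : V → V → ℕ ⁺
D p₁ c₂ = [ 2 ]
D p₁ q₁ = [ 3 ]
D c₂ q₁ = [ 2 ]
D p₂ c₁ = [ 2 ]
D p₂ q₂ = [ 3 ]
D c₁ q₂ = [ 2 ]
D _  _  = ⊤⁺

-- Both directions of the central edge take the default 0. The waits 3 to 0, 3 to 1 and 0 to 1 are
-- then 1, 2 and 1, so all six finite bounds are met with equality.
label : V → V → Fin 4
label p₁ c₁ = suc (suc (suc zero))
label c₁ q₁ = suc zero
label p₂ c₂ = suc (suc (suc zero))
label c₂ q₂ = suc zero
label _  _  = zero

-- Collects what is to be known of a finite entry: the two-edge route and `2 ≤ d` yield the
-- conditions on `D`, and the bound on `gap` yields validity of `label`.
Bounded : V → V → ℕ → Set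
Bounded u v d = ∃[ w ] Edge u w × Edge w v × 2 ≤ d × gap (label u w) (label w v) < d

bounded : ∀ u v → Maybe.All (Bounded u v) (D u v)
bounded = from-yes (all? λ u → all? λ v → Maybe.dec (λ d → any? λ w →
  T? (adj u w) ×-dec T? (adj w v) ×-dec (2 ≤? d) ×-dec (gap (label u w) (label w v) <? d)) (D u v))

gadgetInstance : DiTTR 4 0
gadgetInstance = record
  { tree       = gadget
  ; isTree     = gadget-isTree
  ; D          = D
  ; D-positive = λ {u} {v} _ → positive u v
  ; D-bound    = λ {u} {v} → at-least-distance u v
  }
  where
  positive : ∀ u v → [ 1 ] ≤⁺ D u v
  positive u v with D u v | bounded u v
  ... | ⊤⁺    | _ = _ ≤⊤⁺
  ... | [ d ] | just (_ , _ , _ , 2≤d , _) = [ ≤-trans (s≤s z≤n) 2≤d ]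

  at-least-distance : ∀ u v {d} → u ≢ v → IsDistance G u v d → [ d + 0 ] ≤⁺ D u v
  at-least-distance u v {d} u≢v (_ , shortest) with D u v | bounded u v
  ... | ⊤⁺    | _ = _ ≤⊤⁺
  ... | [ m ] | just (w , uw , wv , 2≤m , _) =
    [ ≤-trans (≤-reflexive (+-identityʳ d)) (≤-trans (shortest (twoHop gadget-isTree u≢v uw wv)) 2≤m) ]

open DiTTR gadgetInstance using (Valid; Realizable; EnforcesEqual)

realizable : Realizable
realizable = lab , valid
  where
  lab : Labeling G 4
  lab (u , v , _) = label u v

  valid : Valid lab
  valid {u} {v} u≢v D≡d with just (w , uw , wv , _ , gap<d) ← subst (Maybe.All (Bounded u v)) D≡d (bounded u v) =
    let p , p-fastest , dur = fastest gadget-isTree u≢v uw wv lab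
    in p , p-fastest , ≤-trans (≤-reflexive dur) gap<d

-- Equality of the two central labels.

valid⇒gap< : (lab : Labeling G 4) → Valid lab → ∀ u w v {d} (uw : Edge u w) (wv : Edge w v) →
  u ≢ v → D u v ≡ [ d ] → gap (lab (u , w , uw)) (lab (w , v , wv)) < d
valid⇒gap< lab valid u w v uw wv u≢v D≡d =
  let p , _ , dur≤d = valid u≢v D≡d
  in ≤-trans (gap<duration gadget-isTree u≢v uw wv lab p) dur≤d

-- The constraints at one centre, with `a` entering from a leaf and `b` leaving to the other: x - y
-- is 0 or 1 modulo 4. Difference 0 is a separate case because `gap` of equal labels is 4, not 0.
star-labels : ∀ (x y a b : Fin 4) → gap a x < 2 → gap a b < 3 → gap y b < 2 → x ≡ y ⊎ gap y x < 2
star-labels = from-yes (all? {4} λ x → all? {4} λ y → all? {4} λ a → all? {4} λ b →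
  (gap a x <? 2) →-dec (gap a b <? 3) →-dec (gap y b <? 2) →-dec ((x ≟ y) ⊎-dec (gap y x <? 2)))

-- If x - y and y - x were both 1, their sum would give 2 = 0 modulo 4.
gap-asym : ∀ (x y : Fin 4) → gap y x < 2 → ¬ gap x y < 2
gap-asym = from-yes (all? {4} λ x → all? {4} λ y → (gap y x <? 2) →-dec ¬? (gap x y <? 2))

enforcesEqual : EnforcesEqual c₁ c₂ _
enforcesEqual lab valid = combine
  (star-labels x y (lab (p₁ , c₁ , _)) (lab (c₁ , q₁ , _))
     (gap< p₁ c₁ c₂ _ _ (λ ()) refl) (gap< p₁ c₁ q₁ _ _ (λ ()) refl) (gap< c₂ c₁ q₁ _ _ (λ ()) refl))
  -- At `c₂` the outgoing central edge carries `y` and the incoming one `x`, so the roles are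
  -- exchanged.
  (star-labels y x (lab (p₂ , c₂ , _)) (lab (c₂ , q₂ , _))
     (gap< p₂ c₂ c₁ _ _ (λ ()) refl) (gap< p₂ c₂ q₂ _ _ (λ ()) refl) (gap< c₁ c₂ q₂ _ _ (λ ()) refl))
  where
  x = lab (c₁ , c₂ , _)
  y = lab (c₂ , c₁ , _)
  gap< = valid⇒gap< lab valid

  combine : x ≡ y ⊎ gap y x < 2 → y ≡ x ⊎ gap x y < 2 → x ≡ y
  combine (inj₁ x≡y) _          = x≡y
  combine (inj₂ _)   (inj₁ y≡x) = sym y≡x
  combine (inj₂ yx)  (inj₂ xy)  = contradiction xy (gap-asym x y yx)

lemma16 : Σ[ I ∈ DiTTR 4 0 ]
    (DiTTR.Realizable I ×
    (Σ[ v₁ ∈ DiTTR.V I ] Σ[ v₂ ∈ DiTTR.V I ] Σ[ e ∈ DiTTR.Edge I v₁ v₂ ]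
    DiTTR.EnforcesEqual I v₁ v₂ e))
lemma16 = gadgetInstance , realizable , c₁ , c₂ , _ , enforcesEqual
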